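{- Let $r$ be a positive integer and $0\le n\le m$ integers. Then there exist nonnegative integers $a_1,\dots,a_r,b_1,\dots,b_r$ with $b_i\le a_i$ for all $i$ such that $$C_r(m,n)=\frac{\{m\}_r!}{\{m-n\}_r!\,\{n\}_r!}=s_1^{\gamma_r(m,n)}\cdot\phi_r\Bigl(\prod_{i=1}^{r}\begin{Bmatrix}a_i\\ b_i\end{Bmatrix}\Bigr),$$ where $\gamma_r(m,n)=\sum_{i=1}^{m}((i-1)\bmod r)-\sum_{i=1}^{n}((i-1)\bmod r)-\sum_{i=1}^{m-n}((i-1)\bmod r)$. Consequently $C_r(m,n)$ is a polynomial, i.e. lies in $\mathbb{Z}[s_1,s_2,\dots]$.
   Context: Let $s_1,s_2,\dots$ be commuting indeterminates and $\mathbb{Z}[S]=\mathbb{Z}[s_1,s_2,\dots]$. The Lucas polynomials $\{m\}\in\mathbb{Z}[s_1,s_2]$ are defined by $\{0\}=0$, $\{1\}=1$, $\{m\}=s_1\{m-1\}+s_2\{m-2\}$ for $m\ge2$; $\{0\}!=1$, $\{m\}!=\{m\}\cdot\{m-1\}!$, and for $0\le b\le a$ the Lucanomial is $\begin{Bmatrix}a\\ b\end{Bmatrix}=\frac{\{a\}!}{\{b\}!\{a-b\}!}$, which is known to lie in $\mathbb{Z}[s_1,s_2]$. For a positive integer $r$, $\phi_r:\mathbb{Z}[s_1,s_2]\to\mathbb{Z}[S]$ is the ring homomorphism with $\phi_r(s_1)=s_r$, $\phi_r(s_2)=s_{2r}$. Here $a\bmod r\in\{0,\dots,r-1\}$ is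 the remainder. For $i\ge1$ let $\tau_i$ be a tile of length $i$; a tiling word of $k\ge0$ is a word $\tau_{i_1}\cdots\tau_{i_j}$ with $i_1+\cdots+i_j=k$ (the empty word for $k=0$), with weight $s_{i_1}\cdots s_{i_j}$. For $m\ge0$, $\Delta_{m,r}$ is the set of tiling words of $m$ consisting of $(m\bmod r)$ tiles $\tau_1$ followed by tiles from $\{\tau_r,\tau_{2r}\}$ in any order. The $r$-Lucas polynomials are $\{0\}_r=0$ and $\{m+1\}_r=\sum_{T\in\Delta_{m,r}}\mathrm{wt}(T)$ for $m\ge0$; $\{0\}_r!=1$ and $\{m\}_r!=\{m\}_r\cdot\{m-1\}_r!$. The quotient $C_r(m,n)$ is a priori a rational function in the $s_i$. -}

module Defs where

open import Level using (Level)
open import Algebra.Bundles using (CommutativeRing)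
open import Data.Nat using (ℕ; zero; suc; _≟_; NonZero)
import Data.Nat as N
open import Data.Nat.ListAction using () renaming (sum to sumℕ)
open import Data.Nat.DivMod using (_%_)
open import Data.Bool using (Bool; true; false)
open import Data.List using (List; []; _∷_; _++_; map; concatMap; upTo; filter; replicate; foldr)
import Data.List as L
open import Data.Fin using (Fin)
open import Relation.Binary.PropositionalEquality using (_≡_)

-- Sum of ((i-1) mod r) for i = 1..k  (the building block of γ_r).
modSum : (r : ℕ) → .{{NonZero r}} → ℕ → ℕ
modSum r zero = zero
modSum r (suc k) = modSum r k N.+ (k % r)

-- Words over the two-letter alphabet {τ_r , τ_{2r}} : false = τ_r, true = τ_{2r}.
wordsOfLength : ℕ → List (List Bool)
wordsOfLength zero = [] ∷ []
wordsOfLength (suc ℓ) = concatMap (λ w → (false ∷ w) ∷ (true ∷ w) ∷ []) (wordsOfLength ℓ)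

tileLen : ℕ → Bool → ℕ
tileLen r false = r
tileLen r true = 2 N.* r

-- All words in {τ_r, τ_{2r}} tiling k (lengths ≤ k suffice since r ≥ 1).
rWords : (r : ℕ) → ℕ → List (List Bool)
rWords r k = filter (λ w → sumℕ (map (tileLen r) w) ≟ k) (concatMap wordsOfLength (upTo (suc k)))

-- Δ_{m,r}: tiling words of m (as lists of tile lengths): (m mod r) tiles τ_1
-- followed by tiles from {τ_r, τ_{2r}} in any order.
Delta : (r : ℕ) → .{{NonZero r}} → ℕ → List (List ℕ)
Delta r m = map (λ w → replicate (m % r) 1 ++ map (tileLen r) w) (rWords r (m N.∸ m % r))

module _ {c ℓ : Level} (R : CommutativeRing c ℓ) where
  open CommutativeRing R

  sumR : List Carrier → Carrier
  sumR = foldr _+_ 0#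

  prodR : List Carrier → Carrier
  prodR = foldr _*_ 1#

  powR : Carrier → ℕ → Carrier
  powR x zero = 1#
  powR x (suc k) = x * powR x k

  prodFin : (k : ℕ) → (Fin k → Carrier) → Carrier
  prodFin zero f = 1#
  prodFin (suc k) f = f Fin.zero * prodFin k (λ i → f (Fin.suc i))

  -- Lucas polynomials {m} evaluated at s1 ↦ x, s2 ↦ y.
  lucas : Carrier → Carrier → ℕ → Carrier
  lucas x y zero = 0#
  lucas x y (suc zero) = 1#
  lucas x y (suc (suc m)) = x * lucas x y (suc m) + y * lucas x y m

  lucasFact : Carrier → Carrier → ℕ → Carrier
  lucasFact x y zero = 1#
  lucasFact x y (suc m) = lucas x y (suc m) * lucasFact x y m

  weight : (ℕ → Carrier) → List ℕ → Carrier
  weight s T = prodR (map s T)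

  rLucas : (r : ℕ) → .{{NonZero r}} → (ℕ → Carrier) → ℕ → Carrier
  rLucas r s zero = 0#
  rLucas r s (suc m) = sumR (map (weight s) (Delta r m))

  rLucasFact : (r : ℕ) → .{{NonZero r}} → (ℕ → Carrier) → ℕ → Carrier
  rLucasFact r s zero = 1#
  rLucasFact r s (suc m) = rLucas r s (suc m) * rLucasFact r s m

module Submission where

-- Write k = q r + ρ with ρ < r. A word of Δ_{k,r} is ρ tiles τ_1 followed by a tiling of q r by
-- τ_r and τ_{2r}, i.e. (after scaling by r) a tiling of q by tiles of length 1 and 2; hence
-- {k+1}_r = s_1^ρ φ_r({q+1}). Multiplying out, {m}_r! = s_1^{γ(m)} ∏_{i<r} φ_r({a_i}!) where
-- a_i is the number of j < m with j ≡ i (mod r) and γ(m) = Σ_{j<m} (j mod r). With b_i the same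
-- count for n, the differences a_i - b_i are the counts for m - n up to a cyclic shift of the
-- residues, so the factorisations of {m}_r!, {n}_r! and {m-n}_r! give the identity.

open import Defs
open import Level using (0ℓ)
open import Algebra.Bundles using (CommutativeRing)
open import Data.Nat using (ℕ; _+_; _*_; _∸_; _≤_; NonZero)
open import Data.Fin using (Fin)
open import Data.Product using (Σ; _×_)

open import Data.Nat using (zero; suc; _<_; _≮_; s≤s; _<?_; _≟_; _≡ᵇ_; >-nonZero⁻¹)
import Data.Nat.Properties as ℕ
open import Data.Nat.DivMod
  using (_/_; _%_; _mod_; m≡m%n+[m/n]*n; [m+kn]%n≡m%n; m<n⇒m%n≡m; m<n⇒m/n≡0; m*n/n≡m; m%n<n; +-distrib-/-∣ʳ; 0/n≡0)
open import Data.Nat.Divisibility using (n∣m*n)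
open import Data.Nat.ListAction using () renaming (sum to sumℕ)
open import Data.Nat.Solver using (module +-*-Solver)
open import Data.Bool using (Bool; true; false; if_then_else_)
open import Data.List using (List; []; _∷_; _++_; map; filter; concatMap; upTo; applyUpTo; replicate)
open import Data.List.Properties using (map-++; map-∘; filter-≐; map-upTo; concatMap-map)
open import Data.List.Effectful using (module MonadProperties)
import Data.Fin as Fin
open import Data.Fin using (toℕ)
open import Data.Fin.Properties using (toℕ-fromℕ<; toℕ-injective; toℕ<n; suc-injective)
open import Data.Product using (_,_; proj₁; proj₂)
open import Data.Maybe using (nothing)
open import Data.Empty using (⊥-elim)
open import Function using (_∘_)
open import Relation.Nullary using (Dec; yes; no; does)
open import Relation.Unary using (Pred; Decidable)
open import Relation.Binary.PropositionalEquality as ≡ using (_≡_; _≢_)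

lessThan : ℕ → ℕ → ℕ
lessThan i       zero    = 0
lessThan zero    (suc j) = 1
lessThan (suc i) (suc j) = lessThan i j

module _ where
  open ≡

  lessThan-< : ∀ {i j} → i < j → lessThan i j ≡ 1
  lessThan-< {zero}  {suc j} _       = refl
  lessThan-< {suc i} {suc j} (s≤s p) = lessThan-< p

  lessThan-≥ : ∀ {i j} → j ≤ i → lessThan i j ≡ 0
  lessThan-≥ {i}     {zero}  _       = refl
  lessThan-≥ {suc i} {suc j} (s≤s p) = lessThan-≥ p

  lessThan-suc-≢ : ∀ {i j} → i ≢ j → lessThan i (suc j) ≡ lessThan i j
  lessThan-suc-≢ {zero}  {zero}  i≢j = ⊥-elim (i≢j refl)
  lessThan-suc-≢ {zero}  {suc j} _   = refl
  lessThan-suc-≢ {suc i} {zero}  _   = refl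
  lessThan-suc-≢ {suc i} {suc j} i≢j = lessThan-suc-≢ (i≢j ∘ cong suc)

module _ (r : ℕ) .{{_ : NonZero r}} where
  open ≡
  open ≡-Reasoning

  -- The number of j < k with j % r ≡ toℕ i.
  residueCount : ℕ → Fin r → ℕ
  residueCount k i = k / r + lessThan (toℕ i) (k % r)

  private
    toℕ-mod : ∀ k → toℕ (k mod r) ≡ k % r
    toℕ-mod k = toℕ-fromℕ< (m%n<n k r)

    ≢-mod : ∀ {k} {i : Fin r} → i ≢ k mod r → toℕ i ≢ k % r
    ≢-mod {k} i≢k e = i≢k (toℕ-injective (trans e (sym (toℕ-mod k))))

    divMod-unique : ∀ {k ρ q} → k ≡ ρ + q * r → ρ < r → k % r ≡ ρ × k / r ≡ q
    divMod-unique {ρ = ρ} {q} refl ρ<r =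
      trans ([m+kn]%n≡m%n ρ q r) (m<n⇒m%n≡m ρ<r) ,
      (begin
        (ρ + q * r) / r     ≡⟨ +-distrib-/-∣ʳ ρ (n∣m*n q) ⟩
        ρ / r + q * r / r   ≡⟨ cong₂ _+_ (m<n⇒m/n≡0 ρ<r) (m*n/n≡m q r) ⟩
        q                   ∎)

    divMod-suc : ∀ k → suc (k % r) < r → suc k % r ≡ suc (k % r) × suc k / r ≡ k / r
    divMod-suc k = divMod-unique (cong suc (m≡m%n+[m/n]*n k r))

    divMod-suc-carry : ∀ k → suc (k % r) ≡ r → suc k % r ≡ 0 × suc k / r ≡ suc (k / r)
    divMod-suc-carry k e = divMod-unique (trans (cong suc (m≡m%n+[m/n]*n k r)) (cong (_+ k / r * r) e)) (>-nonZero⁻¹ r)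

    divMod-+ : ∀ n t → n + t ≡ (n % r + t % r) + (n / r + t / r) * r
    divMod-+ n t = trans (cong₂ _+_ (m≡m%n+[m/n]*n n r) (m≡m%n+[m/n]*n t r))
      (solve 5 (λ a b c d x → (a :+ b :* x) :+ (c :+ d :* x) := (a :+ c) :+ (b :+ d) :* x) refl (n % r) (n / r) (t % r) (t / r) r)
      where open +-*-Solver

  residueCount-zero : ∀ i → residueCount 0 i ≡ 0
  residueCount-zero i = cong₂ (λ q ρ → q + lessThan (toℕ i) ρ) (0/n≡0 r) (m<n⇒m%n≡m (>-nonZero⁻¹ r))

  residueCount-self : ∀ k → residueCount k (k mod r) ≡ k / r
  residueCount-self k rewrite toℕ-mod k = trans (cong (k / r +_) (lessThan-≥ (ℕ.≤-refl {k % r}))) (ℕ.+-identityʳ (k / r))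

  private
    residueCount-via : ∀ {k ρ q} i → k % r ≡ ρ × k / r ≡ q → residueCount k i ≡ q + lessThan (toℕ i) ρ
    residueCount-via i (ρ≡ , q≡) = cong₂ (λ q ρ → q + lessThan (toℕ i) ρ) q≡ ρ≡

    carry : ∀ k → suc (k % r) ≮ r → suc (k % r) ≡ r
    carry k h = ℕ.≤-antisym (m%n<n k r) (ℕ.≮⇒≥ h)

  residueCount-suc-self : ∀ k → residueCount (suc k) (k mod r) ≡ suc (residueCount k (k mod r))
  residueCount-suc-self k = trans (lemma (suc (k % r) <? r)) (cong suc (sym (residueCount-self k)))
    where
    lemma : Dec (suc (k % r) < r) → residueCount (suc k) (k mod r) ≡ suc (k / r)
    lemma (yes h) = begin
      residueCount (suc k) (k mod r)                 ≡⟨ residueCount-via (k mod r) (divMod-suc k h) ⟩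
      k / r + lessThan (toℕ (k mod r)) (suc (k % r)) ≡⟨ cong (λ j → k / r + lessThan j (suc (k % r))) (toℕ-mod k) ⟩
      k / r + lessThan (k % r) (suc (k % r))         ≡⟨ cong (k / r +_) (lessThan-< (ℕ.n<1+n (k % r))) ⟩
      k / r + 1                                      ≡⟨ ℕ.+-comm (k / r) 1 ⟩
      suc (k / r)                                    ∎
    lemma (no h) = trans (residueCount-via (k mod r) (divMod-suc-carry k (carry k h))) (ℕ.+-identityʳ (suc (k / r)))

  residueCount-suc-other : ∀ k {i} → i ≢ k mod r → residueCount (suc k) i ≡ residueCount k i
  residueCount-suc-other k {i} i≢k = lemma (suc (k % r) <? r)
    where
    lemma : Dec (suc (k % r) < r) → residueCount (suc k) i ≡ residueCount k i
    lemma (yes h) = trans (residueCount-via i (divMod-suc k h)) (cong (k / r +_) (lessThan-suc-≢ (≢-mod i≢k)))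
    lemma (no h) = begin
        residueCount (suc k) i           ≡⟨ residueCount-via i (divMod-suc-carry k (carry k h)) ⟩
        suc (k / r) + 0                  ≡⟨ ℕ.+-identityʳ (suc (k / r)) ⟩
        suc (k / r)                      ≡⟨ ℕ.+-comm (k / r) 1 ⟨
        k / r + 1                        ≡⟨ cong (k / r +_) (sym (lessThan-< i<k)) ⟩
        k / r + lessThan (toℕ i) (k % r) ∎
      where
      i<k : toℕ i < k % r
      i<k = ℕ.≤∧≢⇒< (ℕ.≤-pred (subst (toℕ i <_) (sym (carry k h)) (toℕ<n i))) (≢-mod i≢k)

  residueCount-mono-suc : ∀ k i → residueCount k i ≤ residueCount (suc k) i
  residueCount-mono-suc k i with i Fin.≟ k mod r
  ... | yes refl = subst (residueCount k i ≤_) (sym (residueCount-suc-self k)) (ℕ.n≤1+n _)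
  ... | no i≢k   = ℕ.≤-reflexive (sym (residueCount-suc-other k i≢k))

  residueCount-mono-+ : ∀ n t i → residueCount n i ≤ residueCount (n + t) i
  residueCount-mono-+ n zero    i = ℕ.≤-reflexive (cong (λ k → residueCount k i) (sym (ℕ.+-identityʳ n)))
  residueCount-mono-+ n (suc t) i = ℕ.≤-trans (residueCount-mono-+ n t i)
    (subst (λ k → residueCount (n + t) i ≤ residueCount k i) (sym (ℕ.+-suc n t)) (residueCount-mono-suc (n + t) i))

  residueCount-+ : ∀ n t → residueCount (n + t) ((n + t) mod r) ≡ residueCount n ((n + t) mod r) + t / r
  residueCount-+ n t = trans (residueCount-self (n + t)) (sym (lemma (n % r + t % r <? r)))
    where
    j = toℕ ((n + t) mod r)
    lemma : Dec (n % r + t % r < r) → (n / r + lessThan j (n % r)) + t / r ≡ (n + t) / r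
    lemma (yes h) = begin
        (n / r + lessThan j (n % r)) + t / r ≡⟨ cong (λ b → (n / r + b) + t / r) (lessThan-≥ n%r≤j) ⟩
        (n / r + 0) + t / r                  ≡⟨ cong (_+ t / r) (ℕ.+-identityʳ (n / r)) ⟩
        n / r + t / r                        ≡⟨ proj₂ split ⟨
        (n + t) / r                          ∎
      where
      split = divMod-unique (divMod-+ n t) h
      n%r≤j : n % r ≤ j
      n%r≤j = subst (n % r ≤_) (sym (trans (toℕ-mod (n + t)) (proj₁ split))) (ℕ.m≤m+n (n % r) (t % r))
    lemma (no h) = begin
        (n / r + lessThan j (n % r)) + t / r ≡⟨ cong (λ b → (n / r + b) + t / r) (lessThan-< j<n%r) ⟩
        (n / r + 1) + t / r                  ≡⟨ cong (_+ t / r) (ℕ.+-comm (n / r) 1) ⟩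
        suc (n / r + t / r)                  ≡⟨ proj₂ split ⟨
        (n + t) / r                          ∎
      where
      e = n % r + t % r ∸ r
      e+r : e + r ≡ n % r + t % r
      e+r = ℕ.m∸n+n≡m (ℕ.≮⇒≥ h)
      e<r : e < r
      e<r = ℕ.+-cancelʳ-< r e r (subst (_< r + r) (sym e+r) (ℕ.+-mono-< (m%n<n n r) (m%n<n t r)))
      split = divMod-unique (trans (divMod-+ n t) (trans (cong (_+ (n / r + t / r) * r) (sym e+r))
                (ℕ.+-assoc e r ((n / r + t / r) * r)))) e<r
      j<n%r : j < n % r
      j<n%r = subst (_< n % r) (sym (trans (toℕ-mod (n + t)) (proj₁ split)))
                (ℕ.+-cancelʳ-< r e (n % r) (subst (_< n % r + r) (sym e+r) (ℕ.+-monoʳ-< (n % r) (m%n<n t r))))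

  residueCount-∸ : ∀ n t → residueCount (n + t) ((n + t) mod r) ∸ residueCount n ((n + t) mod r) ≡ t / r
  residueCount-∸ n t = trans (cong (_∸ residueCount n ((n + t) mod r)) (residueCount-+ n t))
                             (ℕ.m+n∸m≡n (residueCount n ((n + t) mod r)) (t / r))

  residueCount-mono : ∀ {n m} → n ≤ m → ∀ i → residueCount n i ≤ residueCount m i
  residueCount-mono {n} n≤m i =
    subst (λ k → residueCount n i ≤ residueCount k i) (ℕ.m+[n∸m]≡n n≤m) (residueCount-mono-+ n _ i)

module _ {ℓ₁ ℓ₂} (R : CommutativeRing ℓ₁ ℓ₂) where
  open CommutativeRing R hiding (zero) renaming (_+_ to _+ᴿ_; _*_ to _*ᴿ_)
  open import Relation.Binary.Reasoning.Setoid setoid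
  open import Algebra.Properties.CommutativeSemigroup *-commutativeSemigroup using (x∙yz≈y∙xz; interchange)

  powR-+ : ∀ x m n → powR R x (m + n) ≈ powR R x m *ᴿ powR R x n
  powR-+ x zero    n = sym (*-identityˡ _)
  powR-+ x (suc m) n = trans (*-congˡ (powR-+ x m n)) (sym (*-assoc _ _ _))

  prodR-++ : ∀ xs ys → prodR R (xs ++ ys) ≈ prodR R xs *ᴿ prodR R ys
  prodR-++ []       ys = sym (*-identityˡ _)
  prodR-++ (x ∷ xs) ys = trans (*-congˡ (prodR-++ xs ys)) (sym (*-assoc _ _ _))

  weight-++ : ∀ s us vs → weight R s (us ++ vs) ≈ weight R s us *ᴿ weight R s vs
  weight-++ s us vs = trans (reflexive (≡.cong (prodR R) (map-++ s us vs))) (prodR-++ (map s us) (map s vs))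

  weight-ones : ∀ s n → weight R s (replicate n 1) ≡ powR R (s 1) n
  weight-ones s zero    = ≡.refl
  weight-ones s (suc n) = ≡.cong (s 1 *ᴿ_) (weight-ones s n)

  prodFin-cong : ∀ {k} {f g : Fin k → Carrier} → (∀ i → f i ≈ g i) → prodFin R k f ≈ prodFin R k g
  prodFin-cong {zero}  f≈g = refl
  prodFin-cong {suc k} f≈g = *-cong (f≈g Fin.zero) (prodFin-cong (f≈g ∘ Fin.suc))

  prodFin-ones : ∀ k → prodFin R k (λ _ → 1#) ≈ 1#
  prodFin-ones zero    = refl
  prodFin-ones (suc k) = trans (*-identityˡ _) (prodFin-ones k)

  prodFin-* : ∀ k (f g : Fin k → Carrier) → prodFin R k (λ i → f i *ᴿ g i) ≈ prodFin R k f *ᴿ prodFin R k g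
  prodFin-* zero    f g = sym (*-identityˡ 1#)
  prodFin-* (suc k) f g = trans (*-congˡ (prodFin-* k (f ∘ Fin.suc) (g ∘ Fin.suc))) (interchange _ _ _ _)

  prodFin-update : ∀ {k} (f g : Fin k → Carrier) (j : Fin k) x →
                   f j ≈ x *ᴿ g j → (∀ i → i ≢ j → f i ≈ g i) → prodFin R k f ≈ x *ᴿ prodFin R k g
  prodFin-update f g Fin.zero x fj≈ f≈g =
    trans (*-cong fj≈ (prodFin-cong (λ i → f≈g (Fin.suc i) λ ()))) (*-assoc _ _ _)
  prodFin-update f g (Fin.suc j) x fj≈ f≈g =
    trans (*-cong (f≈g Fin.zero λ ())
                  (prodFin-update (f ∘ Fin.suc) (g ∘ Fin.suc) j x fj≈ (λ i i≢j → f≈g (Fin.suc i) (i≢j ∘ suc-injective))))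
          (x∙yz≈y∙xz _ _ _)

  sumR-cong : ∀ {a} {A : Set a} {f g : A → Carrier} → (∀ w → f w ≈ g w) → ∀ ws → sumR R (map f ws) ≈ sumR R (map g ws)
  sumR-cong f≈g []       = refl
  sumR-cong f≈g (w ∷ ws) = +-cong (f≈g w) (sumR-cong f≈g ws)

  sumR-*ˡ : ∀ {a} {A : Set a} x (f : A → Carrier) ws → sumR R (map (λ w → x *ᴿ f w) ws) ≈ x *ᴿ sumR R (map f ws)
  sumR-*ˡ x f []       = sym (zeroʳ x)
  sumR-*ˡ x f (w ∷ ws) = trans (+-congˡ (sumR-*ˡ x f ws)) (sym (distribˡ _ _ _))

  sumR-zeros : ∀ {a} {A : Set a} (ws : List A) → sumR R (map (λ _ → 0#) ws) ≈ 0#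
  sumR-zeros []       = refl
  sumR-zeros (w ∷ ws) = trans (+-identityˡ _) (sumR-zeros ws)

  select : Bool → Carrier → Carrier
  select b x = if b then x else 0#

  select-*ˡ : ∀ b x y → select b (x *ᴿ y) ≈ x *ᴿ select b y
  select-*ˡ true  x y = refl
  select-*ˡ false x y = sym (zeroʳ x)

  sumR-filter : ∀ {a p} {A : Set a} {P : Pred A p} (P? : Decidable P) (f : A → Carrier) ws →
                sumR R (map f (filter P? ws)) ≈ sumR R (map (λ w → select (does (P? w)) (f w)) ws)
  sumR-filter P? f [] = refl
  sumR-filter P? f (w ∷ ws) with does (P? w)
  ... | true  = +-congˡ (sumR-filter P? f ws)
  ... | false = trans (sumR-filter P? f ws) (sym (+-identityˡ _))

scaledLength : List Bool → ℕ
scaledLength []          = 0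
scaledLength (false ∷ w) = suc (scaledLength w)
scaledLength (true  ∷ w) = suc (suc (scaledLength w))

tileSum≡scaledLength*r : ∀ r w → sumℕ (map (tileLen r) w) ≡ scaledLength w * r
tileSum≡scaledLength*r r []          = ≡.refl
tileSum≡scaledLength*r r (false ∷ w) = ≡.cong (r +_) (tileSum≡scaledLength*r r w)
tileSum≡scaledLength*r r (true  ∷ w) = begin
  (r + (r + 0)) + sumℕ (map (tileLen r) w) ≡⟨ ≡.cong (λ n → (r + n) + sumℕ (map (tileLen r) w)) (ℕ.+-identityʳ r) ⟩
  (r + r) + sumℕ (map (tileLen r) w)       ≡⟨ ℕ.+-assoc r r _ ⟩
  r + (r + sumℕ (map (tileLen r) w))       ≡⟨ ≡.cong (λ n → r + (r + n)) (tileSum≡scaledLength*r r w) ⟩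
  r + (r + scaledLength w * r)             ∎
  where open ≡.≡-Reasoning

extend : List Bool → List (List Bool)
extend w = (false ∷ w) ∷ (true ∷ w) ∷ []

wordsShorterThan : ℕ → List (List Bool)
wordsShorterThan N = concatMap wordsOfLength (upTo N)

wordsShorterThan-suc : ∀ N → wordsShorterThan (suc N) ≡ [] ∷ concatMap extend (wordsShorterThan N)
wordsShorterThan-suc N = ≡.cong ([] ∷_) (begin
  concatMap wordsOfLength (applyUpTo suc N)             ≡⟨ ≡.cong (concatMap wordsOfLength) (map-upTo suc N) ⟨
  concatMap wordsOfLength (map suc (upTo N))            ≡⟨ concatMap-map wordsOfLength suc (upTo N) ⟩
  concatMap (wordsOfLength ∘ suc) (upTo N)              ≡⟨ MonadProperties.associative (upTo N) wordsOfLength extend ⟩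
  concatMap extend (concatMap wordsOfLength (upTo N))   ∎)
  where open ≡.≡-Reasoning

rWords-multiple : ∀ r .{{_ : NonZero r}} q →
                  rWords r (q * r) ≡ filter (λ w → scaledLength w ≟ q) (wordsShorterThan (suc (q * r)))
rWords-multiple r q =
  filter-≐ (λ w → sumℕ (map (tileLen r) w) ≟ q * r) (λ w → scaledLength w ≟ q) (to , from) (wordsShorterThan (suc (q * r)))
  where
  to : ∀ {w} → sumℕ (map (tileLen r) w) ≡ q * r → scaledLength w ≡ q
  to {w} e = ℕ.*-cancelʳ-≡ (scaledLength w) q r (≡.trans (≡.sym (tileSum≡scaledLength*r r w)) e)
  from : ∀ {w} → scaledLength w ≡ q → sumℕ (map (tileLen r) w) ≡ q * r
  from {w} e = ≡.trans (tileSum≡scaledLength*r r w) (≡.cong (_* r) e)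

module _ {ℓ₁ ℓ₂} (R : CommutativeRing ℓ₁ ℓ₂) (s : ℕ → CommutativeRing.Carrier R) (r : ℕ) .{{_ : NonZero r}} where
  open CommutativeRing R hiding (zero) renaming (_+_ to _+ᴿ_; _*_ to _*ᴿ_)
  open import Relation.Binary.Reasoning.Setoid setoid
  open import Algebra.Properties.CommutativeSemigroup *-commutativeSemigroup using (interchange)
  open import Tactic.RingSolver.Core.AlmostCommutativeRing using (fromCommutativeRing)
  open import Tactic.RingSolver.NonReflective (fromCommutativeRing R (λ _ → nothing)) using (solve; _⊜_; _⊕_; _⊗_)

  private
    x = s r
    y = s (2 * r)
    L = lucasFact R x y
    luc = lucas R x y

  wordWeight : List Bool → Carrier
  wordWeight w = weight R s (map (tileLen r) w)

  wordSum : (ℕ → Bool) → List (List Bool) → Carrier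
  wordSum p ws = sumR R (map (λ w → select R (p (scaledLength w)) (wordWeight w)) ws)

  wordSum-extend : ∀ p ws →
    wordSum p (concatMap extend ws) ≈ x *ᴿ wordSum (p ∘ suc) ws +ᴿ y *ᴿ wordSum (p ∘ suc ∘ suc) ws
  wordSum-extend p [] = sym (trans (+-cong (zeroʳ x) (zeroʳ y)) (+-identityˡ 0#))
  wordSum-extend p (w ∷ ws) = begin
      select R (p (suc (scaledLength w))) (x *ᴿ wordWeight w) +ᴿ
        (select R (p (suc (suc (scaledLength w)))) (y *ᴿ wordWeight w) +ᴿ wordSum p (concatMap extend ws))
        ≈⟨ +-cong (select-*ˡ R _ x (wordWeight w)) (+-cong (select-*ˡ R _ y (wordWeight w)) (wordSum-extend p ws)) ⟩
      x *ᴿ a +ᴿ (y *ᴿ b +ᴿ (x *ᴿ A +ᴿ y *ᴿ B))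
        ≈⟨ solve 6 (λ x y a b A B → ((x ⊗ a) ⊕ ((y ⊗ b) ⊕ ((x ⊗ A) ⊕ (y ⊗ B)))) ⊜ ((x ⊗ (a ⊕ A)) ⊕ (y ⊗ (b ⊕ B))))
                   refl x y a b A B ⟩
      x *ᴿ (a +ᴿ A) +ᴿ y *ᴿ (b +ᴿ B) ∎
    where
    a = select R (p (suc (scaledLength w))) (wordWeight w)
    b = select R (p (suc (suc (scaledLength w)))) (wordWeight w)
    A = wordSum (p ∘ suc) ws
    B = wordSum (p ∘ suc ∘ suc) ws

  wordSum-shorterThan-suc : ∀ p N → wordSum p (wordsShorterThan (suc N)) ≈
    select R (p 0) 1# +ᴿ (x *ᴿ wordSum (p ∘ suc) (wordsShorterThan N) +ᴿ y *ᴿ wordSum (p ∘ suc ∘ suc) (wordsShorterThan N))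
  wordSum-shorterThan-suc p N =
    trans (reflexive (≡.cong (wordSum p) (wordsShorterThan-suc N))) (+-congˡ (wordSum-extend p (wordsShorterThan N)))

  -- Splitting off the first tile gives the Lucas recurrence.
  wordSum-lucas : ∀ {N} q → q < N → wordSum (_≡ᵇ q) (wordsShorterThan N) ≈ lucas R x y (suc q)
  wordSum-lucas {suc N} zero _ = begin
      wordSum (_≡ᵇ 0) (wordsShorterThan (suc N))       ≈⟨ wordSum-shorterThan-suc (_≡ᵇ 0) N ⟩
      1# +ᴿ (x *ᴿ Z +ᴿ y *ᴿ Z)                         ≈⟨ +-congˡ (+-cong (*-congˡ (sumR-zeros R W))
                                                                          (*-congˡ (sumR-zeros R W))) ⟩
      1# +ᴿ (x *ᴿ 0# +ᴿ y *ᴿ 0#)                       ≈⟨ +-congˡ (trans (+-cong (zeroʳ x) (zeroʳ y)) (+-identityˡ 0#)) ⟩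
      1# +ᴿ 0#                                         ≈⟨ +-identityʳ 1# ⟩
      1#                                               ∎
    where
    W = wordsShorterThan N
    Z = sumR R (map (λ _ → 0#) W)
  wordSum-lucas {suc N} (suc zero) (s≤s 1≤N) =
    trans (wordSum-shorterThan-suc (_≡ᵇ 1) N)
      (trans (+-identityˡ _) (+-cong (*-congˡ (wordSum-lucas zero 1≤N)) (*-congˡ (sumR-zeros R (wordsShorterThan N)))))
  wordSum-lucas {suc N} (suc (suc q)) (s≤s q+2≤N) =
    trans (wordSum-shorterThan-suc (_≡ᵇ suc (suc q)) N)
      (trans (+-identityˡ _) (+-cong (*-congˡ (wordSum-lucas (suc q) q+2≤N))
                                     (*-congˡ (wordSum-lucas q (ℕ.<-trans (ℕ.n<1+n q) q+2≤N)))))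

  sumR-rWords : ∀ q → sumR R (map wordWeight (rWords r (q * r))) ≈ lucas R x y (suc q)
  sumR-rWords q = begin
    sumR R (map wordWeight (rWords r (q * r)))
      ≡⟨ ≡.cong (sumR R ∘ map wordWeight) (rWords-multiple r q) ⟩
    sumR R (map wordWeight (filter (λ w → scaledLength w ≟ q) (wordsShorterThan (suc (q * r)))))
      ≈⟨ sumR-filter R (λ w → scaledLength w ≟ q) wordWeight (wordsShorterThan (suc (q * r))) ⟩
    wordSum (_≡ᵇ q) (wordsShorterThan (suc (q * r)))
      ≈⟨ wordSum-lucas q (s≤s (ℕ.m≤m*n q r)) ⟩
    lucas R x y (suc q) ∎

  rLucas-suc : ∀ m → rLucas R r s (suc m) ≈ powR R (s 1) (m % r) *ᴿ lucas R x y (suc (m / r))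
  rLucas-suc m = begin
    rLucas R r s (suc m)
      ≡⟨⟩
    sumR R (map (weight R s) (map prefix Ws))
      ≡⟨ ≡.cong (sumR R) (map-∘ Ws) ⟨
    sumR R (map (weight R s ∘ prefix) Ws)
      ≈⟨ sumR-cong R weight-prefix Ws ⟩
    sumR R (map (λ w → powR R (s 1) ρ *ᴿ wordWeight w) Ws)
      ≈⟨ sumR-*ˡ R (powR R (s 1) ρ) wordWeight Ws ⟩
    powR R (s 1) ρ *ᴿ sumR R (map wordWeight Ws)
      ≈⟨ *-congˡ (reflexive (≡.cong (sumR R ∘ map wordWeight ∘ rWords r) m∸ρ≡q*r)) ⟩
    powR R (s 1) ρ *ᴿ sumR R (map wordWeight (rWords r (m / r * r)))
      ≈⟨ *-congˡ (sumR-rWords (m / r)) ⟩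
    powR R (s 1) ρ *ᴿ lucas R x y (suc (m / r)) ∎
    where
    ρ = m % r
    Ws = rWords r (m ∸ ρ)
    prefix : List Bool → List ℕ
    prefix w = replicate ρ 1 ++ map (tileLen r) w
    weight-prefix : ∀ w → weight R s (prefix w) ≈ powR R (s 1) ρ *ᴿ wordWeight w
    weight-prefix w = trans (weight-++ R s (replicate ρ 1) _) (*-congʳ (reflexive (weight-ones R s ρ)))
    m∸ρ≡q*r : m ∸ ρ ≡ m / r * r
    m∸ρ≡q*r = ≡.trans (≡.cong (_∸ ρ) (m≡m%n+[m/n]*n m r)) (ℕ.m+n∸m≡n ρ _)

  lucasFactProd : (Fin r → ℕ) → Carrier
  lucasFactProd e = prodFin R r (L ∘ e)

  lucasFactProd-0 : ∀ {e} → (∀ i → e i ≡ 0) → lucasFactProd e ≈ 1#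
  lucasFactProd-0 e≡0 = trans (prodFin-cong R (λ i → reflexive (≡.cong L (e≡0 i)))) (prodFin-ones R r)

  lucasFactProd-suc : ∀ e e' j → e' j ≡ suc (e j) → (∀ i → i ≢ j → e' i ≡ e i) →
                      lucasFactProd e' ≈ luc (suc (e j)) *ᴿ lucasFactProd e
  lucasFactProd-suc e e' j e'j≡ e'≡ =
    prodFin-update R (L ∘ e') (L ∘ e) j _ (reflexive (≡.cong L e'j≡)) (λ i i≢j → reflexive (≡.cong L (e'≡ i i≢j)))

  lucasFactProd-residueCount-suc : ∀ k →
    lucasFactProd (residueCount r (suc k)) ≈ luc (suc (k / r)) *ᴿ lucasFactProd (residueCount r k)
  lucasFactProd-residueCount-suc k =
    trans (lucasFactProd-suc _ _ (k mod r) (residueCount-suc-self r k) (λ i → residueCount-suc-other r k))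
      (*-congʳ (reflexive (≡.cong (luc ∘ suc) (residueCount-self r k))))

  rLucasFact-factorisation : ∀ m → rLucasFact R r s m ≈ powR R (s 1) (modSum r m) *ᴿ lucasFactProd (residueCount r m)
  rLucasFact-factorisation zero = sym (trans (*-identityˡ _) (lucasFactProd-0 (residueCount-zero r)))
  rLucasFact-factorisation (suc m) = begin
    rLucas R r s (suc m) *ᴿ rLucasFact R r s m
      ≈⟨ *-cong (rLucas-suc m) (rLucasFact-factorisation m) ⟩
    (powR R (s 1) (m % r) *ᴿ luc (suc (m / r))) *ᴿ (powR R (s 1) (modSum r m) *ᴿ lucasFactProd (residueCount r m))
      ≈⟨ interchange _ _ _ _ ⟩
    (powR R (s 1) (m % r) *ᴿ powR R (s 1) (modSum r m)) *ᴿ (luc (suc (m / r)) *ᴿ lucasFactProd (residueCount r m))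
      ≈⟨ *-cong (trans (*-comm _ _) (sym (powR-+ R (s 1) (modSum r m) (m % r)))) (sym (lucasFactProd-residueCount-suc m)) ⟩
    powR R (s 1) (modSum r (suc m)) *ᴿ lucasFactProd (residueCount r (suc m)) ∎

  -- The residue counts of n + t exceed those of n by a permutation of the residue counts of t;
  -- inducting on t avoids constructing that permutation.
  lucasFactProd-residueCount-+ : ∀ n t →
    lucasFactProd (λ i → residueCount r (n + t) i ∸ residueCount r n i) ≈ lucasFactProd (residueCount r t)
  lucasFactProd-residueCount-+ n zero = trans (lucasFactProd-0 n+0−n≡0) (sym (lucasFactProd-0 (residueCount-zero r)))
    where
    n+0−n≡0 : ∀ i → residueCount r (n + 0) i ∸ residueCount r n i ≡ 0
    n+0−n≡0 i = ≡.trans (≡.cong (λ k → residueCount r k i ∸ residueCount r n i) (ℕ.+-identityʳ n))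
                        (ℕ.n∸n≡0 (residueCount r n i))
  lucasFactProd-residueCount-+ n (suc t) = begin
    lucasFactProd (λ i → count (n + suc t) i ∸ count n i)
      ≈⟨ lucasFactProd-suc _ _ j step-at-j step-elsewhere ⟩
    luc (suc (count (n + t) j ∸ count n j)) *ᴿ lucasFactProd (λ i → count (n + t) i ∸ count n i)
      ≈⟨ *-cong (reflexive (≡.cong (luc ∘ suc) (residueCount-∸ r n t))) (lucasFactProd-residueCount-+ n t) ⟩
    luc (suc (t / r)) *ᴿ lucasFactProd (count t)
      ≈⟨ lucasFactProd-residueCount-suc t ⟨
    lucasFactProd (count (suc t)) ∎
    where
    count = residueCount r
    j = (n + t) mod r
    +-suc : ∀ i → count (n + suc t) i ≡ count (suc (n + t)) i
    +-suc i = ≡.cong (λ k → count k i) (ℕ.+-suc n t)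
    step-at-j : count (n + suc t) j ∸ count n j ≡ suc (count (n + t) j ∸ count n j)
    step-at-j = ≡.trans (≡.cong (_∸ count n j) (≡.trans (+-suc j) (residueCount-suc-self r (n + t))))
                  (ℕ.+-∸-assoc 1 (residueCount-mono-+ r n t j))
    step-elsewhere : ∀ i → i ≢ j → count (n + suc t) i ∸ count n i ≡ count (n + t) i ∸ count n i
    step-elsewhere i i≢j = ≡.cong (_∸ count n i) (≡.trans (+-suc i) (residueCount-suc-other r (n + t) i≢j))

  lucasFactProd-residueCount-∸ : ∀ {n m} → n ≤ m →
    lucasFactProd (λ i → residueCount r m i ∸ residueCount r n i) ≈ lucasFactProd (residueCount r (m ∸ n))
  lucasFactProd-residueCount-∸ {n} {m} n≤m =
    ≡.subst (λ k → lucasFactProd (λ i → residueCount r k i ∸ residueCount r n i) ≈ lucasFactProd (residueCount r (m ∸ n)))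
      (ℕ.m+[n∸m]≡n n≤m) (lucasFactProd-residueCount-+ n (m ∸ n))

  rLucanomial-identity : ∀ {n m} → n ≤ m →
    (rLucasFact R r s m *ᴿ powR R (s 1) (modSum r n + modSum r (m ∸ n))) *ᴿ
      prodFin R r (λ i → L (residueCount r n i) *ᴿ L (residueCount r m i ∸ residueCount r n i))
    ≈ ((rLucasFact R r s (m ∸ n) *ᴿ rLucasFact R r s n) *ᴿ powR R (s 1) (modSum r m)) *ᴿ
      prodFin R r (λ i → L (residueCount r m i))
  rLucanomial-identity {n} {m} n≤m = begin
    (rLucasFact R r s m *ᴿ Pw (γ n + γ t)) *ᴿ prodFin R r (λ i → L (b i) *ᴿ L (a i ∸ b i))
      ≈⟨ *-cong (*-cong (rLucasFact-factorisation m) (powR-+ R (s 1) (γ n) (γ t)))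
                (trans (prodFin-* R r _ _) (*-congˡ (lucasFactProd-residueCount-∸ n≤m))) ⟩
    ((Pw (γ m) *ᴿ Π a) *ᴿ (Pw (γ n) *ᴿ Pw (γ t))) *ᴿ (Π b *ᴿ Π c)
      ≈⟨ ⊙-solve 6 (λ Pm Πa Pn Pt Πb Πc → ((Pm ⊙ Πa) ⊙ (Pn ⊙ Pt)) ⊙ (Πb ⊙ Πc) ⊜' (((Pt ⊙ Πc) ⊙ (Pn ⊙ Πb)) ⊙ Pm) ⊙ Πa)
                   refl (Pw (γ m)) (Π a) (Pw (γ n)) (Pw (γ t)) (Π b) (Π c) ⟩
    (((Pw (γ t) *ᴿ Π c) *ᴿ (Pw (γ n) *ᴿ Π b)) *ᴿ Pw (γ m)) *ᴿ Π a
      ≈⟨ *-congʳ (*-congʳ (*-cong (rLucasFact-factorisation t) (rLucasFact-factorisation n))) ⟨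
    ((rLucasFact R r s t *ᴿ rLucasFact R r s n) *ᴿ Pw (γ m)) *ᴿ Π a ∎
    where
    open import Algebra.Solver.CommutativeMonoid *-commutativeMonoid
      using () renaming (solve to ⊙-solve; _⊕_ to _⊙_; _⊜_ to _⊜'_)
    t = m ∸ n
    a = residueCount r m
    b = residueCount r n
    c = residueCount r t
    γ = modSum r
    Pw = powR R (s 1)
    Π = lucasFactProd

theorem4p5 : (r : ℕ) → .{{_ : NonZero r}} → (m n : ℕ) → n ≤ m →
  Σ (Fin r → ℕ) λ a → Σ (Fin r → ℕ) λ b →
    ((i : Fin r) → b i ≤ a i) ×
    ((R : CommutativeRing 0ℓ 0ℓ) (s : ℕ → CommutativeRing.Carrier R) →
      CommutativeRing._≈_ R
        (CommutativeRing._*_ R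
          (CommutativeRing._*_ R (rLucasFact R r s m)
            (powR R (s 1) (modSum r n + modSum r (m ∸ n))))
          (prodFin R r λ i → CommutativeRing._*_ R
            (lucasFact R (s r) (s (2 * r)) (b i))
            (lucasFact R (s r) (s (2 * r)) (a i ∸ b i))))
        (CommutativeRing._*_ R
          (CommutativeRing._*_ R
            (CommutativeRing._*_ R (rLucasFact R r s (m ∸ n)) (rLucasFact R r s n))
            (powR R (s 1) (modSum r m)))
          (prodFin R r λ i → lucasFact R (s r) (s (2 * r)) (a i))))
theorem4p5 r m n n≤m =
  residueCount r m , residueCount r n , residueCount-mono r n≤m , λ R s → rLucanomial-identity R s r n≤m
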